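{- Let $p$ be an odd prime and let $\chi$ be the quadratic character modulo $p$ on $\mathbb F_p$. For $(\varepsilon_1,\varepsilon_2)\in\{\pm1\}^2$ define \[ N(\varepsilon_1,\varepsilon_2)=\#\{n\in\mathbb F_p:\ \chi(n)=\varepsilon_1,\ \chi(n+1)=\varepsilon_2\}. \] Then for every $(\varepsilon_1,\varepsilon_2)\in\{\pm1\}^2$, \[ N(\varepsilon_1,\varepsilon_2)=\frac14 \begin{cases} p-2-(\varepsilon_2+\varepsilon_1+\varepsilon_1\varepsilon_2), & \text{if } p\equiv 1\pmod 4,\\[1mm] p-2-(\varepsilon_2-\varepsilon_1+\varepsilon_1\varepsilon_2), & \text{if } p\equiv 3\pmod 4. \end{cases} \] In particular, the distribution of pairs is symmetric, i.e. $N(\varepsilon_1,\varepsilon_2)=N(\varepsilon_2,\varepsilon_1)$ for all $(\varepsilon_1,\varepsilon_2)\in\{\pm1\}^2$, if and only if $p\equiv 1\pmod 4$.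
   Context: $\mathbb F_p=\mathbb Z/p\mathbb Z$. The quadratic character $\chi$ modulo $p$ (Legendre symbol) is the function $\chi:\mathbb F_p\to\{ -1,0,1\}$ with $\chi(0)=0$, $\chi(x)=1$ if $x$ is a nonzero square in $\mathbb F_p$, and $\chi(x)=-1$ if $x$ is not a square in $\mathbb F_p$. -}

module Defs where

open import Data.Nat as ℕ using (ℕ; NonZero)
open import Data.Nat.DivMod using (_mod_)
open import Data.Fin using (Fin; toℕ)
open import Data.Fin.Properties using (_≟_; any?)
open import Data.Integer as ℤ using (ℤ; 0ℤ; 1ℤ; -1ℤ)
open import Data.List using (length; filter; allFin)
open import Data.Product using (∃)
open import Data.Sum using (_⊎_)
open import Relation.Nullary using (Dec; yes; no)
open import Relation.Nullary.Decidable using (_×-dec_)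
open import Relation.Binary.PropositionalEquality using (_≡_)

-- ℤ/pℤ, carried by the least non-negative residues.
𝔽 : ℕ → Set
𝔽 p = Fin p

module _ {p : ℕ} .{{_ : NonZero p}} where

  infixl 6 _+ₚ_
  infixl 7 _*ₚ_

  0ₚ 1ₚ : 𝔽 p
  0ₚ = 0 mod p
  1ₚ = 1 mod p

  _+ₚ_ _*ₚ_ : 𝔽 p → 𝔽 p → 𝔽 p
  x +ₚ y = (toℕ x ℕ.+ toℕ y) mod p
  x *ₚ y = (toℕ x ℕ.* toℕ y) mod p

  IsSquare : 𝔽 p → Set
  IsSquare x = ∃ λ (y : 𝔽 p) → y *ₚ y ≡ x

  isSquare? : (x : 𝔽 p) → Dec (IsSquare x)
  isSquare? x = any? (λ y → y *ₚ y ≟ x)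

  χ : 𝔽 p → ℤ
  χ x with x ≟ 0ₚ | isSquare? x
  ... | yes _ | _     = 0ℤ
  ... | no  _ | yes _ = 1ℤ
  ... | no  _ | no  _ = -1ℤ

N : (p : ℕ) .{{_ : NonZero p}} → ℤ → ℤ → ℕ
N p ε₁ ε₂ =
  length (filter (λ n → (χ n ℤ.≟ ε₁) ×-dec (χ (n +ₚ 1ₚ) ℤ.≟ ε₂)) (allFin p))

IsPlusMinusOne : ℤ → Set
IsPlusMinusOne ε = ε ≡ 1ℤ ⊎ ε ≡ -1ℤ

{-# OPTIONS --safe #-}

-- The equation y² = x has 1 + χ(x) solutions y.  Summing over x gives Σ χ(x) = 0.
-- Summing (1 + χ(x)) (1 + χ(x + 1)) counts the solutions of z² = y² + 1; with
-- z = y + u this reads u (u + 2y) = 1, which has one solution y for each u ≠ 0, so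
-- Σ χ(x) χ(x + 1) = -1.
-- For n ≠ 0, -1 the product (1 + ε₁ χ(n)) (1 + ε₂ χ(n + 1)) is four times the
-- indicator of χ(n) = ε₁, χ(n + 1) = ε₂, whence
--   4 N(ε₁, ε₂) = p - 2 - (ε₂ + ε₁ χ(-1) + ε₁ ε₂).
-- For ε₁ = ε₂ = 1 this says p = 4 N(1, 1) + 4 + χ(-1), so integrality of N(1, 1)
-- already forces χ(-1) ≡ p (mod 4).

module Submission where

open import Defs
open import Algebra.Bundles using (CommutativeRing)
open import Algebra.Definitions using (Associative; Commutative; LeftIdentity; LeftInverse; _DistributesOverˡ_)
open import Data.Bool using (if_then_else_; true; false)
open import Data.Fin as Fin using (Fin; toℕ; zero; suc; punchOut)
open import Data.Fin.Permutation using (permutation)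
open import Data.Fin.Properties as Fin using (any?; injective⇒≤; punchOut-injective; toℕ-fromℕ<; toℕ-injective; toℕ<n)
open import Data.Integer using (ℤ; +_; _+_; _-_; _*_; 0ℤ; 1ℤ; -1ℤ)
open import Data.Integer.Properties as ℤ using ()
open import Data.Integer.Tactic.RingSolver using (solve-∀)
open import Data.List using (length; filter; tabulate)
open import Data.Nat as ℕ using (ℕ; NonZero; _%_; zero; suc; _∸_)
open import Data.Nat.Divisibility using (_∣_; _∣0; ∣-refl; m%n≡0⇒n∣m; n∣m⇒m%n≡0; ∣1⇒≡1)
open import Data.Nat.DivMod using (_mod_; %-distribˡ-+; %-distribˡ-*; m%n%n≡m%n; m<n⇒m%n≡m; [m+kn]%n≡m%n)
open import Data.Nat.Primality using (Prime; euclidsLemma; prime⇒irreducible; prime[2]; ¬prime[1])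
open import Data.Nat.Properties as ℕ using ()
open import Data.Product using (_×_; _,_; ∃; proj₁; proj₂)
open import Data.Rational using (_/_)
open import Data.Rational.Properties using (fromℚᵘ-cong)
open import Data.Rational.Unnormalised using (mkℚᵘ; *≡*)
open import Data.Sum using (_⊎_; inj₁; inj₂; [_,_]′)
open import Function using (_∘_; id; Injective; mk⇔)
open import Function.Bundles using (_⇔_)
open import Level using (0ℓ)
open import Relation.Binary.PropositionalEquality
open import Relation.Nullary using (¬_; Dec; yes; no; does; contradiction)
open import Relation.Nullary.Decidable using (_×-dec_; dec-true; dec-false; does-⇔)
open import Relation.Unary using (Pred; Decidable)

import Algebra.Consequences.Propositional as Consequences
import Algebra.Properties.Group as GroupProperties
import Algebra.Properties.Ring as RingProperties
import Algebra.Solver.Ring.NaturalCoefficients.Default as SemiringSolver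

open import Algebra.Properties.Semiring.Sum ℤ.+-*-semiring

open ≡-Reasoning

module ℤ-ring = RingProperties ℤ.+-*-ring

private variable
  n : ℕ
  A B : Set

-- Indicators and finite sums

δ : Dec A → ℤ
δ a? = if does a? then 1ℤ else 0ℤ

δ-yes : (a? : Dec A) → A → δ a? ≡ 1ℤ
δ-yes a? a = cong (if_then 1ℤ else 0ℤ) (dec-true a? a)

δ-no : (a? : Dec A) → ¬ A → δ a? ≡ 0ℤ
δ-no a? ¬a = cong (if_then 1ℤ else 0ℤ) (dec-false a? ¬a)

δ-cong : (a? : Dec A) (b? : Dec B) → (A → B) → (B → A) → δ a? ≡ δ b?
δ-cong a? b? f g = cong (if_then 1ℤ else 0ℤ) (does-⇔ (mk⇔ f g) a? b?)

∑-one : ∀ n → ∑[ i < n ] 1ℤ ≡ + n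
∑-one zero    = refl
∑-one (suc n) = cong (_+_ 1ℤ) (∑-one n)

∑-zero : (f : Fin n → ℤ) → (∀ i → f i ≡ 0ℤ) → ∑[ i < n ] f i ≡ 0ℤ
∑-zero {n} f f≡0 = trans (sum-cong-≗ f≡0) (sum-replicate-zero n)

∑-sift : (a : Fin n) (g : Fin n → ℤ) → ∑[ i < n ] (δ (a Fin.≟ i) * g i) ≡ g a
∑-sift zero    g = trans (cong₂ _+_ (ℤ.*-identityˡ (g zero)) (∑-zero _ (ℤ.*-zeroˡ ∘ g ∘ suc))) (ℤ.+-identityʳ _)
∑-sift (suc a) g = trans (cong₂ _+_ (ℤ.*-zeroˡ (g zero)) (∑-sift a (g ∘ suc))) (ℤ.+-identityˡ _)

∑-δ : (a : Fin n) → ∑[ i < n ] δ (a Fin.≟ i) ≡ 1ℤ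
∑-δ a = trans (sum-cong-≗ λ i → sym (ℤ.*-identityʳ (δ (a Fin.≟ i)))) (∑-sift a (λ _ → 1ℤ))

-- Pigeonhole: if `j` were missed, punching `j` out of every value would give an injection from
-- `Fin (suc n)` into `Fin n`.
injective⇒surjective : (f : Fin n → Fin n) → Injective _≡_ _≡_ f → ∀ j → ∃ λ i → f i ≡ j
injective⇒surjective {suc n} f inj j with any? (λ i → f i Fin.≟ j)
... | yes hit = hit
... | no miss = contradiction (injective⇒≤ {f = λ i → punchOut (j≢f i)} (inj ∘ punchOut-injective (j≢f _) (j≢f _))) ℕ.1+n≰n
  where
  j≢f : ∀ i → j ≢ f i
  j≢f i eq = miss (i , sym eq)

-- An injective self-map of a finite set is a permutation: the right inverse supplied by
-- surjectivity is also a left inverse, since `f` cancels from `f (f⁻¹ (f i)) ≡ f i`.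
∑-reindex : (f : Fin n → Fin n) → Injective _≡_ _≡_ f → (g : Fin n → ℤ) → ∑[ i < n ] g (f i) ≡ ∑[ j < n ] g j
∑-reindex f inj g = sym (∑-permute g (permutation f f⁻¹ f∘f⁻¹ (inj ∘ f∘f⁻¹ ∘ f)))
  where
  f⁻¹ = proj₁ ∘ injective⇒surjective f inj
  f∘f⁻¹ = proj₂ ∘ injective⇒surjective f inj

∑-*ˡ : ∀ c (f : Fin n → ℤ) → ∑[ i < n ] (c * f i) ≡ c * ∑[ i < n ] f i
∑-*ˡ c f = sym (*-distribˡ-sum c f)

∑-product : ∀ a b (f g : Fin n → ℤ) →
  ∑[ i < n ] ((1ℤ + a * f i) * (1ℤ + b * g i)) ≡
  + n + a * (∑[ i < n ] f i) + b * (∑[ i < n ] g i) + a * b * (∑[ i < n ] (f i * g i))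
∑-product {n} a b f g = begin
  ∑[ i < n ] ((1ℤ + a * f i) * (1ℤ + b * g i))
    ≡⟨ sum-cong-≗ (λ i → expand a b (f i) (g i)) ⟩
  ∑[ i < n ] (1ℤ + a * f i + b * g i + a * b * (f i * g i))
    ≡⟨ ∑-distrib-+ (λ i → 1ℤ + a * f i + b * g i) (λ i → a * b * (f i * g i)) ⟩
  ∑[ i < n ] (1ℤ + a * f i + b * g i) + ∑[ i < n ] (a * b * (f i * g i))
    ≡⟨ cong₂ _+_ (∑-distrib-+ (λ i → 1ℤ + a * f i) (λ i → b * g i)) (∑-*ˡ (a * b) (λ i → f i * g i)) ⟩
  ∑[ i < n ] (1ℤ + a * f i) + ∑[ i < n ] (b * g i) + a * b * (∑[ i < n ] (f i * g i))
    ≡⟨ cong (_+ a * b * (∑[ i < n ] (f i * g i)))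
         (cong₂ _+_ (trans (∑-distrib-+ (λ _ → 1ℤ) (λ i → a * f i)) (cong₂ _+_ (∑-one n) (∑-*ˡ a f))) (∑-*ˡ b g)) ⟩
  + n + a * (∑[ i < n ] f i) + b * (∑[ i < n ] g i) + a * b * (∑[ i < n ] (f i * g i)) ∎
  where
  expand : ∀ a b x y → (1ℤ + a * x) * (1ℤ + b * y) ≡ 1ℤ + a * x + b * y + a * b * (x * y)
  expand = solve-∀

-- As `allFin p` is `tabulate id`, this turns the list length that defines `N` into a sum of
-- indicators.
length-filter-tabulate : {P : Pred A 0ℓ} (P? : Decidable P) (f : Fin n → A) →
  + length (filter P? (tabulate f)) ≡ ∑[ i < n ] δ (P? (f i))
length-filter-tabulate {n = zero}  P? f = refl
length-filter-tabulate {n = suc n} P? f with does (P? (f zero))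
... | true  = cong (_+_ 1ℤ) (length-filter-tabulate P? (f ∘ suc))
... | false = trans (length-filter-tabulate P? (f ∘ suc)) (sym (ℤ.+-identityˡ _))

-- The ring ℤ/pℤ

module _ {p : ℕ} .{{_ : NonZero p}} where

  infix 8 -ₚ_

  -- The outer reduction matters at x = 0, where the difference is p itself.
  -ₚ_ : 𝔽 p → 𝔽 p
  -ₚ x = (p ∸ toℕ x) mod p

  toℕ-mod : ∀ m → toℕ (m mod p) ≡ m % p
  toℕ-mod m = toℕ-fromℕ< _

  mod-cong : ∀ {m n} → m % p ≡ n % p → m mod p ≡ n mod p
  mod-cong {m} {n} eq = toℕ-injective (trans (toℕ-mod m) (trans eq (sym (toℕ-mod n))))

  toℕ-mod-inverse : ∀ (x : 𝔽 p) → toℕ x mod p ≡ x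
  toℕ-mod-inverse x = toℕ-injective (trans (toℕ-mod (toℕ x)) (m<n⇒m%n≡m (toℕ<n x)))

  -- With its variants below, this pulls each ring law of `𝔽 p` back to the same law of ℕ: a reduced
  -- operand may be replaced by any representative.
  mod-+ˡ : ∀ m (x : 𝔽 p) → (m mod p) +ₚ x ≡ (m ℕ.+ toℕ x) mod p
  mod-+ˡ m x = mod-cong (begin
    (toℕ (m mod p) ℕ.+ toℕ x) % p   ≡⟨ cong (λ k → (k ℕ.+ toℕ x) % p) (toℕ-mod m) ⟩
    (m % p ℕ.+ toℕ x) % p           ≡⟨ %-distribˡ-+ (m % p) (toℕ x) p ⟩
    (m % p % p ℕ.+ toℕ x % p) % p   ≡⟨ cong (λ k → (k ℕ.+ toℕ x % p) % p) (m%n%n≡m%n m p) ⟩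
    (m % p ℕ.+ toℕ x % p) % p       ≡⟨ %-distribˡ-+ m (toℕ x) p ⟨
    (m ℕ.+ toℕ x) % p               ∎)

  mod-*ˡ : ∀ m (x : 𝔽 p) → (m mod p) *ₚ x ≡ (m ℕ.* toℕ x) mod p
  mod-*ˡ m x = mod-cong (begin
    (toℕ (m mod p) ℕ.* toℕ x) % p   ≡⟨ cong (λ k → (k ℕ.* toℕ x) % p) (toℕ-mod m) ⟩
    (m % p ℕ.* toℕ x) % p           ≡⟨ %-distribˡ-* (m % p) (toℕ x) p ⟩
    (m % p % p ℕ.* (toℕ x % p)) % p ≡⟨ cong (λ k → (k ℕ.* (toℕ x % p)) % p) (m%n%n≡m%n m p) ⟩
    (m % p ℕ.* (toℕ x % p)) % p     ≡⟨ %-distribˡ-* m (toℕ x) p ⟨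
    (m ℕ.* toℕ x) % p               ∎)

  +ₚ-comm : Commutative _≡_ (_+ₚ_ {p})
  +ₚ-comm x y = cong (_mod p) (ℕ.+-comm (toℕ x) (toℕ y))

  *ₚ-comm : Commutative _≡_ (_*ₚ_ {p})
  *ₚ-comm x y = cong (_mod p) (ℕ.*-comm (toℕ x) (toℕ y))

  mod-+ʳ : ∀ (x : 𝔽 p) m → x +ₚ (m mod p) ≡ (toℕ x ℕ.+ m) mod p
  mod-+ʳ x m = trans (+ₚ-comm x (m mod p)) (trans (mod-+ˡ m x) (cong (_mod p) (ℕ.+-comm m (toℕ x))))

  mod-*ʳ : ∀ (x : 𝔽 p) m → x *ₚ (m mod p) ≡ (toℕ x ℕ.* m) mod p
  mod-*ʳ x m = trans (*ₚ-comm x (m mod p)) (trans (mod-*ˡ m x) (cong (_mod p) (ℕ.*-comm m (toℕ x))))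

  mod-+ : ∀ m n → (m mod p) +ₚ (n mod p) ≡ (m ℕ.+ n) mod p
  mod-+ m n = trans (mod-+ˡ m (n mod p)) (mod-cong (begin
    (m ℕ.+ toℕ (n mod p)) % p     ≡⟨ cong (λ k → (m ℕ.+ k) % p) (toℕ-mod n) ⟩
    (m ℕ.+ n % p) % p             ≡⟨ %-distribˡ-+ m (n % p) p ⟩
    (m % p ℕ.+ n % p % p) % p     ≡⟨ cong (λ k → (m % p ℕ.+ k) % p) (m%n%n≡m%n n p) ⟩
    (m % p ℕ.+ n % p) % p         ≡⟨ %-distribˡ-+ m n p ⟨
    (m ℕ.+ n) % p                 ∎))

  +ₚ-assoc : Associative _≡_ (_+ₚ_ {p})
  +ₚ-assoc x y z = begin
    (x +ₚ y) +ₚ z                            ≡⟨ mod-+ˡ (toℕ x ℕ.+ toℕ y) z ⟩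
    (toℕ x ℕ.+ toℕ y ℕ.+ toℕ z) mod p        ≡⟨ cong (_mod p) (ℕ.+-assoc (toℕ x) (toℕ y) (toℕ z)) ⟩
    (toℕ x ℕ.+ (toℕ y ℕ.+ toℕ z)) mod p      ≡⟨ mod-+ʳ x (toℕ y ℕ.+ toℕ z) ⟨
    x +ₚ (y +ₚ z)                            ∎

  *ₚ-assoc : Associative _≡_ (_*ₚ_ {p})
  *ₚ-assoc x y z = begin
    (x *ₚ y) *ₚ z                            ≡⟨ mod-*ˡ (toℕ x ℕ.* toℕ y) z ⟩
    (toℕ x ℕ.* toℕ y ℕ.* toℕ z) mod p        ≡⟨ cong (_mod p) (ℕ.*-assoc (toℕ x) (toℕ y) (toℕ z)) ⟩
    (toℕ x ℕ.* (toℕ y ℕ.* toℕ z)) mod p      ≡⟨ mod-*ʳ x (toℕ y ℕ.* toℕ z) ⟨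
    x *ₚ (y *ₚ z)                            ∎

  +ₚ-identityˡ : LeftIdentity _≡_ 0ₚ (_+ₚ_ {p})
  +ₚ-identityˡ x = trans (mod-+ˡ 0 x) (toℕ-mod-inverse x)

  *ₚ-identityˡ : LeftIdentity _≡_ 1ₚ (_*ₚ_ {p})
  *ₚ-identityˡ x = trans (mod-*ˡ 1 x) (trans (cong (_mod p) (ℕ.*-identityˡ (toℕ x))) (toℕ-mod-inverse x))

  -- Bridge from vanishing in `𝔽 p` to divisibility in ℕ, where the hypotheses on p live.
  mod≡0⇒∣ : ∀ m → m mod p ≡ 0ₚ → p ∣ m
  mod≡0⇒∣ m eq = m%n≡0⇒n∣m m p (begin
    m % p           ≡⟨ toℕ-mod m ⟨
    toℕ (m mod p)   ≡⟨ cong toℕ eq ⟩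
    toℕ (0ₚ {p})    ≡⟨ toℕ-mod 0 ⟩
    0 % p           ≡⟨ n∣m⇒m%n≡0 0 p (p ∣0) ⟩
    0               ∎)

  ∣⇒mod≡0 : ∀ {m} → p ∣ m → m mod p ≡ 0ₚ
  ∣⇒mod≡0 {m} p∣m = mod-cong (trans (n∣m⇒m%n≡0 m p p∣m) (sym (n∣m⇒m%n≡0 0 p (p ∣0))))

  -ₚ-inverseˡ : LeftInverse _≡_ 0ₚ -ₚ_ _+ₚ_
  -ₚ-inverseˡ x = begin
    -ₚ x +ₚ x                          ≡⟨ mod-+ˡ (p ∸ toℕ x) x ⟩
    (p ∸ toℕ x ℕ.+ toℕ x) mod p        ≡⟨ cong (_mod p) (ℕ.m∸n+n≡m (ℕ.<⇒≤ (toℕ<n x))) ⟩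
    p mod p                            ≡⟨ ∣⇒mod≡0 ∣-refl ⟩
    0ₚ                                 ∎

  *ₚ-distribˡ-+ₚ : _DistributesOverˡ_ _≡_ (_*ₚ_ {p}) _+ₚ_
  *ₚ-distribˡ-+ₚ x y z = begin
    x *ₚ (y +ₚ z)                                     ≡⟨ mod-*ʳ x (toℕ y ℕ.+ toℕ z) ⟩
    (toℕ x ℕ.* (toℕ y ℕ.+ toℕ z)) mod p               ≡⟨ cong (_mod p) (ℕ.*-distribˡ-+ (toℕ x) (toℕ y) (toℕ z)) ⟩
    (toℕ x ℕ.* toℕ y ℕ.+ toℕ x ℕ.* toℕ z) mod p       ≡⟨ mod-+ (toℕ x ℕ.* toℕ y) (toℕ x ℕ.* toℕ z) ⟨
    x *ₚ y +ₚ x *ₚ z                                  ∎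

𝔽-commutativeRing : (p : ℕ) .{{_ : NonZero p}} → CommutativeRing 0ℓ 0ℓ
𝔽-commutativeRing p = record
  { Carrier = 𝔽 p ; _≈_ = _≡_ ; _+_ = _+ₚ_ ; _*_ = _*ₚ_ ; -_ = -ₚ_ ; 0# = 0ₚ ; 1# = 1ₚ
  ; isCommutativeRing = record
    { isRing = record
      { +-isAbelianGroup = record
        { isGroup = record
          { isMonoid = record
            { isSemigroup = record
              { isMagma = record { isEquivalence = isEquivalence ; ∙-cong = cong₂ _+ₚ_ }
              ; assoc = +ₚ-assoc
              }
            ; identity = Consequences.comm∧idˡ⇒id +ₚ-comm +ₚ-identityˡ
            }
          ; inverse = Consequences.comm∧invˡ⇒inv +ₚ-comm -ₚ-inverseˡ
          ; ⁻¹-cong = cong -ₚ_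
          }
        ; comm = +ₚ-comm
        }
      ; *-cong = cong₂ _*ₚ_
      ; *-assoc = *ₚ-assoc
      ; *-identity = Consequences.comm∧idˡ⇒id *ₚ-comm *ₚ-identityˡ
      ; distrib = *ₚ-distribˡ-+ₚ , Consequences.comm∧distrˡ⇒distrʳ *ₚ-comm *ₚ-distribˡ-+ₚ
      }
    ; *-comm = *ₚ-comm
    }
  }

-- The quadratic character

module _ {p : ℕ} .{{_ : NonZero p}} where

  -- Indexing by the value lets `with χ x | χ-view x` replace `χ x` in the goal and at the same time
  -- hand over the reason for that value.
  data χ-View (x : 𝔽 p) : ℤ → Set where
    isZero    : x ≡ 0ₚ → χ-View x 0ℤ
    square    : x ≢ 0ₚ → IsSquare x → χ-View x 1ℤ
    nonsquare : x ≢ 0ₚ → ¬ IsSquare x → χ-View x -1ℤ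

  χ-view : ∀ x → χ-View x (χ x)
  χ-view x with x Fin.≟ 0ₚ | isSquare? x
  ... | yes x≡0 | _      = isZero x≡0
  ... | no  x≢0 | yes sq = square x≢0 sq
  ... | no  x≢0 | no ¬sq = nonsquare x≢0 ¬sq

  χ-zero : ∀ {x} → x ≡ 0ₚ → χ x ≡ 0ℤ
  χ-zero {x} x≡0 with χ x | χ-view x
  ... | _ | isZero _          = refl
  ... | _ | square x≢0 _      = contradiction x≡0 x≢0
  ... | _ | nonsquare x≢0 _   = contradiction x≡0 x≢0

  χ-nonzero : ∀ {x} → x ≢ 0ₚ → IsPlusMinusOne (χ x)
  χ-nonzero {x} x≢0 with χ x | χ-view x
  ... | _ | isZero x≡0      = contradiction x≡0 x≢0
  ... | _ | square _ _      = inj₁ refl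
  ... | _ | nonsquare _ _   = inj₂ refl

  χ-square : ∀ {x} → x ≢ 0ₚ → IsSquare x → χ x ≡ 1ℤ
  χ-square {x} x≢0 sq with χ x | χ-view x
  ... | _ | isZero x≡0      = contradiction x≡0 x≢0
  ... | _ | square _ _      = refl
  ... | _ | nonsquare _ ¬sq = contradiction sq ¬sq

-- The indicator of a pair of signs as a product.

4*δ≡product : ∀ {a b ε₁ ε₂} → IsPlusMinusOne a → IsPlusMinusOne b → IsPlusMinusOne ε₁ → IsPlusMinusOne ε₂ →
  + 4 * δ ((a ℤ.≟ ε₁) ×-dec (b ℤ.≟ ε₂)) ≡ (1ℤ + ε₁ * a) * (1ℤ + ε₂ * b)
-- For signs, a factor `1ℤ + ε * a` is 2 when a = ε and 0 otherwise; all sixteen cases hold by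
-- computation.
4*δ≡product (inj₁ refl) (inj₁ refl) (inj₁ refl) (inj₁ refl) = refl
4*δ≡product (inj₁ refl) (inj₁ refl) (inj₁ refl) (inj₂ refl) = refl
4*δ≡product (inj₁ refl) (inj₁ refl) (inj₂ refl) (inj₁ refl) = refl
4*δ≡product (inj₁ refl) (inj₁ refl) (inj₂ refl) (inj₂ refl) = refl
4*δ≡product (inj₁ refl) (inj₂ refl) (inj₁ refl) (inj₁ refl) = refl
4*δ≡product (inj₁ refl) (inj₂ refl) (inj₁ refl) (inj₂ refl) = refl
4*δ≡product (inj₁ refl) (inj₂ refl) (inj₂ refl) (inj₁ refl) = refl
4*δ≡product (inj₁ refl) (inj₂ refl) (inj₂ refl) (inj₂ refl) = refl
4*δ≡product (inj₂ refl) (inj₁ refl) (inj₁ refl) (inj₁ refl) = refl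
4*δ≡product (inj₂ refl) (inj₁ refl) (inj₁ refl) (inj₂ refl) = refl
4*δ≡product (inj₂ refl) (inj₁ refl) (inj₂ refl) (inj₁ refl) = refl
4*δ≡product (inj₂ refl) (inj₁ refl) (inj₂ refl) (inj₂ refl) = refl
4*δ≡product (inj₂ refl) (inj₂ refl) (inj₁ refl) (inj₁ refl) = refl
4*δ≡product (inj₂ refl) (inj₂ refl) (inj₁ refl) (inj₂ refl) = refl
4*δ≡product (inj₂ refl) (inj₂ refl) (inj₂ refl) (inj₁ refl) = refl
4*δ≡product (inj₂ refl) (inj₂ refl) (inj₂ refl) (inj₂ refl) = refl

0≢±1 : ∀ {a ε} → a ≡ 0ℤ → IsPlusMinusOne ε → a ≢ ε
0≢±1 refl (inj₁ refl) ()
0≢±1 refl (inj₂ refl) ()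

-- The case n = 0 of `4*match`: χ(n) vanishes, so the indicator is 0 and the product collapses to
-- its second factor. The coefficients `1ℤ` and `0ℤ` are the values there of the indicators of n = 0
-- and n = -1.
boundaryˡ : ∀ {a ε₁} b ε₂ → a ≡ 0ℤ → IsPlusMinusOne ε₁ →
  + 4 * δ ((a ℤ.≟ ε₁) ×-dec (b ℤ.≟ ε₂)) + 1ℤ * (1ℤ + ε₂ * b) + 0ℤ * (1ℤ + ε₁ * a) ≡ (1ℤ + ε₁ * a) * (1ℤ + ε₂ * b)
boundaryˡ {a} {ε₁} b ε₂ a≡0 ε₁-unit = begin
  + 4 * δ ((a ℤ.≟ ε₁) ×-dec (b ℤ.≟ ε₂)) + 1ℤ * (1ℤ + ε₂ * b) + 0ℤ * (1ℤ + ε₁ * a)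
    ≡⟨ cong₂ (λ d c → + 4 * d + 1ℤ * (1ℤ + ε₂ * b) + 0ℤ * (1ℤ + ε₁ * c))
         (δ-no ((a ℤ.≟ ε₁) ×-dec (b ℤ.≟ ε₂)) (0≢±1 a≡0 ε₁-unit ∘ proj₁)) a≡0 ⟩
  + 4 * 0ℤ + 1ℤ * (1ℤ + ε₂ * b) + 0ℤ * (1ℤ + ε₁ * 0ℤ)
    ≡⟨ identity ε₁ (1ℤ + ε₂ * b) ⟩
  (1ℤ + ε₁ * 0ℤ) * (1ℤ + ε₂ * b)
    ≡⟨ cong (λ c → (1ℤ + ε₁ * c) * (1ℤ + ε₂ * b)) a≡0 ⟨
  (1ℤ + ε₁ * a) * (1ℤ + ε₂ * b) ∎
  where
  identity : ∀ e t → + 4 * 0ℤ + 1ℤ * t + 0ℤ * (1ℤ + e * 0ℤ) ≡ (1ℤ + e * 0ℤ) * t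
  identity = solve-∀

-- The mirror case n = -1, where χ(n + 1) vanishes and the first factor is left over.
boundaryʳ : ∀ a ε₁ {b ε₂} → b ≡ 0ℤ → IsPlusMinusOne ε₂ →
  + 4 * δ ((a ℤ.≟ ε₁) ×-dec (b ℤ.≟ ε₂)) + 0ℤ * (1ℤ + ε₂ * b) + 1ℤ * (1ℤ + ε₁ * a) ≡ (1ℤ + ε₁ * a) * (1ℤ + ε₂ * b)
boundaryʳ a ε₁ {b} {ε₂} b≡0 ε₂-unit = begin
  + 4 * δ ((a ℤ.≟ ε₁) ×-dec (b ℤ.≟ ε₂)) + 0ℤ * (1ℤ + ε₂ * b) + 1ℤ * (1ℤ + ε₁ * a)
    ≡⟨ cong₂ (λ d c → + 4 * d + 0ℤ * (1ℤ + ε₂ * c) + 1ℤ * (1ℤ + ε₁ * a))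
         (δ-no ((a ℤ.≟ ε₁) ×-dec (b ℤ.≟ ε₂)) (0≢±1 b≡0 ε₂-unit ∘ proj₂)) b≡0 ⟩
  + 4 * 0ℤ + 0ℤ * (1ℤ + ε₂ * 0ℤ) + 1ℤ * (1ℤ + ε₁ * a)
    ≡⟨ identity ε₂ (1ℤ + ε₁ * a) ⟩
  (1ℤ + ε₁ * a) * (1ℤ + ε₂ * 0ℤ)
    ≡⟨ cong (λ c → (1ℤ + ε₁ * a) * (1ℤ + ε₂ * c)) b≡0 ⟨
  (1ℤ + ε₁ * a) * (1ℤ + ε₂ * b) ∎
  where
  identity : ∀ e t → + 4 * 0ℤ + 0ℤ * (1ℤ + e * 0ℤ) + 1ℤ * t ≡ t * (1ℤ + e * 0ℤ)
  identity = solve-∀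

-- Field laws of ℤ/pℤ for an odd prime p.

module OddPrime (p : ℕ) .{{_ : NonZero p}} (p-prime : Prime p) (p-odd : ¬ (2 ∣ p)) where

  open CommutativeRing (𝔽-commutativeRing p) using (ring; +-group; commutativeSemiring; distribʳ; -‿inverseʳ; zeroˡ; zeroʳ; +-identityʳ)
  open RingProperties ring using (x[y-z]≈xy-xz)
  open GroupProperties +-group using (∙-cancelˡ; ∙-cancelʳ; x∙y⁻¹≈ε⇒x≈y)

  2ₚ -1ₚ : 𝔽 p
  2ₚ = 1ₚ +ₚ 1ₚ
  -1ₚ = -ₚ 1ₚ

  1ₚ≢0ₚ : 1ₚ {p} ≢ 0ₚ
  1ₚ≢0ₚ eq = ¬prime[1] (subst Prime (∣1⇒≡1 (mod≡0⇒∣ 1 eq)) p-prime)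

  -- Otherwise p divides 2, so p is 1 or 2; primality excludes the first and oddness the second.
  2ₚ≢0ₚ : 2ₚ ≢ 0ₚ
  2ₚ≢0ₚ eq with prime⇒irreducible prime[2] (mod≡0⇒∣ 2 (trans (sym (mod-+ 1 1)) eq))
  ... | inj₁ p≡1 = ¬prime[1] (subst Prime p≡1 p-prime)
  ... | inj₂ refl = p-odd ∣-refl

  -1ₚ+1ₚ≡0ₚ : -1ₚ +ₚ 1ₚ ≡ 0ₚ
  -1ₚ+1ₚ≡0ₚ = -ₚ-inverseˡ 1ₚ

  -1ₚ≢0ₚ : -1ₚ ≢ 0ₚ
  -1ₚ≢0ₚ eq = 1ₚ≢0ₚ (trans (sym (+ₚ-identityˡ 1ₚ)) (trans (cong (_+ₚ 1ₚ) (sym eq)) -1ₚ+1ₚ≡0ₚ))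

  χ[1]≡1 : χ {p} 1ₚ ≡ 1ℤ
  χ[1]≡1 = χ-square 1ₚ≢0ₚ (1ₚ , *ₚ-identityˡ 1ₚ)

  -- Euclid's lemma, applied to the representatives.
  *ₚ-integral : ∀ x y → x *ₚ y ≡ 0ₚ → x ≡ 0ₚ ⊎ y ≡ 0ₚ
  *ₚ-integral x y eq with euclidsLemma (toℕ x) (toℕ y) p-prime (mod≡0⇒∣ _ eq)
  ... | inj₁ p∣x = inj₁ (trans (sym (toℕ-mod-inverse x)) (∣⇒mod≡0 p∣x))
  ... | inj₂ p∣y = inj₂ (trans (sym (toℕ-mod-inverse y)) (∣⇒mod≡0 p∣y))

  *ₚ-cancelˡ : ∀ {x} → x ≢ 0ₚ → Injective _≡_ _≡_ (x *ₚ_)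
  *ₚ-cancelˡ {x} x≢0 {y} {z} eq =
    [ (λ x≡0 → contradiction x≡0 x≢0) , x∙y⁻¹≈ε⇒x≈y y z ]′ (*ₚ-integral x (y +ₚ -ₚ z) (begin
      x *ₚ (y +ₚ -ₚ z)              ≡⟨ x[y-z]≈xy-xz x y z ⟩
      x *ₚ y +ₚ -ₚ (x *ₚ z)         ≡⟨ cong (_+ₚ -ₚ (x *ₚ z)) eq ⟩
      x *ₚ z +ₚ -ₚ (x *ₚ z)         ≡⟨ -‿inverseʳ (x *ₚ z) ⟩
      0ₚ                            ∎))

  -- Counting square roots.

  ∑-translate : ∀ a (g : 𝔽 p → ℤ) → ∑[ u < p ] g (a +ₚ u) ≡ ∑[ z < p ] g z
  ∑-translate a = ∑-reindex (a +ₚ_) (∙-cancelˡ a _ _)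

  -- Factoring out `u` turns (a + u)² = a² + c into u (u + 2a) = c, which is quadratic in u but
  -- linear in a.
  square-shift : ∀ a u → (a +ₚ u) *ₚ (a +ₚ u) ≡ a *ₚ a +ₚ u *ₚ (u +ₚ 2ₚ *ₚ a)
  square-shift a u = begin
    (a +ₚ u) *ₚ (a +ₚ u)                          ≡⟨ expand a u ⟩
    a *ₚ a +ₚ u *ₚ (u +ₚ (a +ₚ a))                ≡⟨ cong (λ t → a *ₚ a +ₚ u *ₚ (u +ₚ (t +ₚ t))) (*ₚ-identityˡ a) ⟨
    a *ₚ a +ₚ u *ₚ (u +ₚ (1ₚ *ₚ a +ₚ 1ₚ *ₚ a))    ≡⟨ cong (λ t → a *ₚ a +ₚ u *ₚ (u +ₚ t)) (distribʳ a 1ₚ 1ₚ) ⟨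
    a *ₚ a +ₚ u *ₚ (u +ₚ 2ₚ *ₚ a)                 ∎
    where
    open SemiringSolver commutativeSemiring
    expand : ∀ a u → (a +ₚ u) *ₚ (a +ₚ u) ≡ a *ₚ a +ₚ u *ₚ (u +ₚ (a +ₚ a))
    expand = solve 2 (λ a u → (a :+ u) :* (a :+ u) := a :* a :+ u :* (u :+ (a :+ a))) refl

  rootCount : 𝔽 p → ℤ
  rootCount x = ∑[ y < p ] δ (y *ₚ y Fin.≟ x)

  -- Substitute y = a + u and cancel a². With c = 0 this counts the square roots of a²; with c = 1
  -- it prepares the equation z² = y² + 1.
  rootCount-shift : ∀ a c → rootCount (a *ₚ a +ₚ c) ≡ ∑[ u < p ] δ (c Fin.≟ u *ₚ (u +ₚ 2ₚ *ₚ a))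
  rootCount-shift a c = trans (sym (∑-translate a λ z → δ (z *ₚ z Fin.≟ a *ₚ a +ₚ c)))
    (sum-cong-≗ λ u → δ-cong ((a +ₚ u) *ₚ (a +ₚ u) Fin.≟ a *ₚ a +ₚ c) (c Fin.≟ u *ₚ (u +ₚ 2ₚ *ₚ a))
      (λ eq → sym (∙-cancelˡ (a *ₚ a) _ _ (trans (sym (square-shift a u)) eq)))
      (λ eq → trans (square-shift a u) (cong (a *ₚ a +ₚ_) (sym eq))))

  rootCount[0] : rootCount 0ₚ ≡ 1ℤ
  rootCount[0] = trans
    (sum-cong-≗ λ y → δ-cong (y *ₚ y Fin.≟ 0ₚ) (0ₚ Fin.≟ y)
      (λ eq → sym ([ id , id ]′ (*ₚ-integral y y eq))) (λ { refl → zeroˡ 0ₚ }))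
    (∑-δ 0ₚ)

  -- After the shift the roots are the zeros of u (u + 2a), namely 0 and -2a; they are distinct
  -- because 2a ≠ 0.
  rootCount[a²] : ∀ a → a ≢ 0ₚ → rootCount (a *ₚ a) ≡ + 2
  rootCount[a²] a a≢0 = begin
    rootCount (a *ₚ a)                                       ≡⟨ cong rootCount (+-identityʳ (a *ₚ a)) ⟨
    rootCount (a *ₚ a +ₚ 0ₚ)                                 ≡⟨ rootCount-shift a 0ₚ ⟩
    ∑[ u < p ] δ (0ₚ Fin.≟ u *ₚ (u +ₚ b))                    ≡⟨ sum-cong-≗ split ⟩
    ∑[ u < p ] (δ (0ₚ Fin.≟ u) + δ (-ₚ b Fin.≟ u))           ≡⟨ ∑-distrib-+ (λ u → δ (0ₚ Fin.≟ u)) (λ u → δ (-ₚ b Fin.≟ u)) ⟩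
    ∑[ u < p ] δ (0ₚ Fin.≟ u) + ∑[ u < p ] δ (-ₚ b Fin.≟ u)  ≡⟨ cong₂ _+_ (∑-δ 0ₚ) (∑-δ (-ₚ b)) ⟩
    + 2                                                      ∎
    where
    b = 2ₚ *ₚ a

    b≢0 : b ≢ 0ₚ
    b≢0 = [ 2ₚ≢0ₚ , a≢0 ]′ ∘ *ₚ-integral 2ₚ a

    split : ∀ u → δ (0ₚ Fin.≟ u *ₚ (u +ₚ b)) ≡ δ (0ₚ Fin.≟ u) + δ (-ₚ b Fin.≟ u)
    split u with 0ₚ Fin.≟ u
    ... | yes refl = trans (δ-yes (0ₚ Fin.≟ _) (sym (zeroˡ (0ₚ +ₚ b))))
      (cong (_+_ 1ℤ) (sym (δ-no (-ₚ b Fin.≟ 0ₚ) λ eq → b≢0 (trans (sym (+ₚ-identityˡ b)) (trans (cong (_+ₚ b) (sym eq)) (-ₚ-inverseˡ b))))))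
    ... | no 0≢u = trans (δ-cong (0ₚ Fin.≟ u *ₚ (u +ₚ b)) (-ₚ b Fin.≟ u)
        (λ eq → [ (λ u≡0 → contradiction (sym u≡0) 0≢u)
                , (λ u+b≡0 → ∙-cancelʳ b _ _ (trans (-ₚ-inverseˡ b) (sym u+b≡0))) ]′ (*ₚ-integral u _ (sym eq)))
        (λ { refl → sym (trans (cong (u *ₚ_) (-ₚ-inverseˡ b)) (zeroʳ u)) }))
      (sym (ℤ.+-identityˡ _))

  rootCount≡1+χ : ∀ x → rootCount x ≡ 1ℤ + χ x
  rootCount≡1+χ x with χ x | χ-view x
  ... | _ | isZero refl = rootCount[0]
  ... | _ | square x≢0 (a , refl) = rootCount[a²] a λ { refl → x≢0 (zeroˡ 0ₚ) }
  ... | _ | nonsquare _ ¬sq = ∑-zero _ λ y → δ-no (y *ₚ y Fin.≟ x) λ eq → ¬sq (y , eq)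

  -- Character sums.

  ∑-rootCount-* : ∀ (g : 𝔽 p → ℤ) → ∑[ x < p ] (rootCount x * g x) ≡ ∑[ y < p ] g (y *ₚ y)
  ∑-rootCount-* g = begin
    -- The y are grouped by their squares: once the sums are exchanged, the inner sum over x keeps
    -- only x = y².
    ∑[ x < p ] (rootCount x * g x)                              ≡⟨ sum-cong-≗ (λ x → *-distribʳ-sum (g x) (λ y → δ (y *ₚ y Fin.≟ x))) ⟩
    ∑[ x < p ] ∑[ y < p ] (δ (y *ₚ y Fin.≟ x) * g x)            ≡⟨ ∑-comm (λ x y → δ (y *ₚ y Fin.≟ x) * g x) ⟩
    ∑[ y < p ] ∑[ x < p ] (δ (y *ₚ y Fin.≟ x) * g x)            ≡⟨ sum-cong-≗ (λ y → ∑-sift (y *ₚ y) g) ⟩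
    ∑[ y < p ] g (y *ₚ y)                                       ∎

  -- Every y squares to exactly one x, so the root counts 1 + χ(x) total p.
  ∑χ≡0 : ∑[ x < p ] χ x ≡ 0ℤ
  ∑χ≡0 = ℤ-ring.+-cancelˡ (+ p) _ _ (begin
    + p + ∑[ x < p ] χ x                 ≡⟨ cong (_+ (∑[ x < p ] χ x)) (∑-one p) ⟨
    ∑[ x < p ] 1ℤ + ∑[ x < p ] χ x       ≡⟨ ∑-distrib-+ (λ _ → 1ℤ) χ ⟨
    ∑[ x < p ] (1ℤ + χ x)                ≡⟨ sum-cong-≗ (λ x → trans (ℤ.*-identityʳ (rootCount x)) (rootCount≡1+χ x)) ⟨
    ∑[ x < p ] (rootCount x * 1ℤ)        ≡⟨ ∑-rootCount-* (λ _ → 1ℤ) ⟩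
    ∑[ y < p ] 1ℤ                        ≡⟨ ∑-one p ⟩
    + p                                  ≡⟨ ℤ.+-identityʳ (+ p) ⟨
    + p + 0ℤ                             ∎)

  ∑χ[n+1]≡0 : ∑[ x < p ] χ (x +ₚ 1ₚ) ≡ 0ℤ
  ∑χ[n+1]≡0 = trans (∑-reindex (_+ₚ 1ₚ) (∙-cancelʳ 1ₚ _ _) χ) ∑χ≡0

  -- For u ≠ 0 the map y ↦ u (u + 2y) is injective, hence bijective, and takes the value 1 exactly
  -- once. For u = 0 no y works and the second indicator makes up for it, so the total is the same
  -- for every u.
  inverse-count : ∀ u → ∑[ y < p ] δ (1ₚ Fin.≟ u *ₚ (u +ₚ 2ₚ *ₚ y)) + δ (0ₚ Fin.≟ u) ≡ 1ℤ
  inverse-count u with 0ₚ Fin.≟ u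
  ... | yes refl = cong (_+ 1ℤ) (∑-zero (λ y → δ (1ₚ Fin.≟ u *ₚ (u +ₚ 2ₚ *ₚ y)))
    λ y → δ-no (1ₚ Fin.≟ u *ₚ (u +ₚ 2ₚ *ₚ y)) λ eq → 1ₚ≢0ₚ (trans eq (zeroˡ (u +ₚ 2ₚ *ₚ y))))
  ... | no 0≢u = trans (ℤ.+-identityʳ _) (trans
    (∑-reindex (λ y → u *ₚ (u +ₚ 2ₚ *ₚ y))
      (λ {y} {z} → *ₚ-cancelˡ 2ₚ≢0ₚ {y} {z} ∘ ∙-cancelˡ u (2ₚ *ₚ y) (2ₚ *ₚ z) ∘ *ₚ-cancelˡ (0≢u ∘ sym) {u +ₚ 2ₚ *ₚ y} {u +ₚ 2ₚ *ₚ z})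
      (λ w → δ (1ₚ Fin.≟ w)))
    (∑-δ 1ₚ))

  ∑-rootCount[y²+1] : ∑[ y < p ] rootCount (y *ₚ y +ₚ 1ₚ) + 1ℤ ≡ + p
  ∑-rootCount[y²+1] = begin
    ∑[ y < p ] rootCount (y *ₚ y +ₚ 1ₚ) + 1ℤ
      -- The sum over u moves outside, and the lone `1ℤ` becomes the sum of the indicators of u = 0,
      -- so that `inverse-count` applies to each u.
      ≡⟨ cong₂ _+_ (trans (sum-cong-≗ λ y → rootCount-shift y 1ₚ) (∑-comm λ y u → δ (1ₚ Fin.≟ u *ₚ (u +ₚ 2ₚ *ₚ y)))) (sym (∑-δ 0ₚ)) ⟩
    ∑[ u < p ] ∑[ y < p ] δ (1ₚ Fin.≟ u *ₚ (u +ₚ 2ₚ *ₚ y)) + ∑[ u < p ] δ (0ₚ Fin.≟ u)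
      ≡⟨ ∑-distrib-+ (λ u → ∑[ y < p ] δ (1ₚ Fin.≟ u *ₚ (u +ₚ 2ₚ *ₚ y))) (λ u → δ (0ₚ Fin.≟ u)) ⟨
    ∑[ u < p ] (∑[ y < p ] δ (1ₚ Fin.≟ u *ₚ (u +ₚ 2ₚ *ₚ y)) + δ (0ₚ Fin.≟ u))
      ≡⟨ sum-cong-≗ inverse-count ⟩
    ∑[ u < p ] 1ℤ
      ≡⟨ ∑-one p ⟩
    + p ∎

  -- Used twice: with a = b = 1 to find the sum of χ(n) χ(n + 1), then with the signs ε₁, ε₂ to
  -- evaluate the count. The linear terms vanish.
  ∑-χ-product : ∀ a b → ∑[ n < p ] ((1ℤ + a * χ n) * (1ℤ + b * χ (n +ₚ 1ₚ))) ≡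
    + p + a * b * (∑[ n < p ] (χ n * χ (n +ₚ 1ₚ)))
  ∑-χ-product a b = begin
    ∑[ n < p ] ((1ℤ + a * χ n) * (1ℤ + b * χ (n +ₚ 1ₚ)))
      ≡⟨ ∑-product a b χ (λ n → χ (n +ₚ 1ₚ)) ⟩
    + p + a * (∑[ n < p ] χ n) + b * (∑[ n < p ] χ (n +ₚ 1ₚ)) + a * b * S
      ≡⟨ cong₂ (λ s t → + p + a * s + b * t + a * b * S) ∑χ≡0 ∑χ[n+1]≡0 ⟩
    + p + a * 0ℤ + b * 0ℤ + a * b * S
      ≡⟨ simplify (+ p) a b (a * b * S) ⟩
    + p + a * b * S ∎
    where
    S = ∑[ n < p ] (χ n * χ (n +ₚ 1ₚ))
    simplify : ∀ q a b s → q + a * 0ℤ + b * 0ℤ + s ≡ q + s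
    simplify = solve-∀

  ∑χ[n]χ[n+1]≡-1 : ∑[ n < p ] (χ n * χ (n +ₚ 1ₚ)) ≡ -1ℤ
  ∑χ[n]χ[n+1]≡-1 = solve-for-S (+ p) S (begin
    + p + 1ℤ * 1ℤ * S + 1ℤ
      ≡⟨ cong (_+ 1ℤ) (∑-χ-product 1ℤ 1ℤ) ⟨
    ∑[ n < p ] ((1ℤ + 1ℤ * χ n) * (1ℤ + 1ℤ * χ (n +ₚ 1ₚ))) + 1ℤ
      -- With coefficients 1 both factors are root counts, so the sum counts the pairs (y, z) with
      -- z² = y² + 1.
      ≡⟨ cong (_+ 1ℤ) (sum-cong-≗ λ n → cong₂ _*_ (count n) (count (n +ₚ 1ₚ))) ⟨
    ∑[ n < p ] (rootCount n * rootCount (n +ₚ 1ₚ)) + 1ℤ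
      ≡⟨ cong (_+ 1ℤ) (∑-rootCount-* (λ n → rootCount (n +ₚ 1ₚ))) ⟩
    ∑[ y < p ] rootCount (y *ₚ y +ₚ 1ₚ) + 1ℤ
      ≡⟨ ∑-rootCount[y²+1] ⟩
    + p ∎)
    where
    S = ∑[ n < p ] (χ n * χ (n +ₚ 1ₚ))
    count : ∀ x → rootCount x ≡ 1ℤ + 1ℤ * χ x
    count x = trans (rootCount≡1+χ x) (cong (_+_ 1ℤ) (sym (ℤ.*-identityˡ (χ x))))
    rearrange-S : ∀ q s → s ≡ q + 1ℤ * 1ℤ * s + 1ℤ - q - 1ℤ
    rearrange-S = solve-∀
    cancel-q : ∀ q → q - q - 1ℤ ≡ -1ℤ
    cancel-q = solve-∀
    solve-for-S : ∀ q s → q + 1ℤ * 1ℤ * s + 1ℤ ≡ q → s ≡ -1ℤ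
    solve-for-S q s eq = trans (rearrange-S q s) (trans (cong (λ t → t - q - 1ℤ) eq) (cancel-q q))

  -- Evaluation of the pair count.

  module _ {ε₁ ε₂ : ℤ} (ε₁-unit : IsPlusMinusOne ε₁) (ε₂-unit : IsPlusMinusOne ε₂) where

    private
      match : 𝔽 p → ℤ
      match n = δ ((χ n ℤ.≟ ε₁) ×-dec (χ (n +ₚ 1ₚ) ℤ.≟ ε₂))

      -- The two factors of the product, each named after the point where it is left over because
      -- the other factor equals 1.
      at-0 at--1 : 𝔽 p → ℤ
      at-0 n = 1ℤ + ε₂ * χ (n +ₚ 1ₚ)
      at--1 n = 1ℤ + ε₁ * χ n

    -- At n = 0 and n = -1 no match is possible although the product may be nonzero; the two
    -- indicator terms correct for this and are later evaluated by `∑-sift`.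
    4*match : ∀ n → + 4 * match n + δ (0ₚ Fin.≟ n) * at-0 n + δ (-1ₚ Fin.≟ n) * at--1 n ≡ at--1 n * at-0 n
    4*match n with 0ₚ Fin.≟ n | -1ₚ Fin.≟ n
    ... | yes refl | yes eq = contradiction eq -1ₚ≢0ₚ
    ... | yes refl | no _   = boundaryˡ (χ (n +ₚ 1ₚ)) ε₂ (χ-zero {x = n} refl) ε₁-unit
    ... | no _ | yes refl   = boundaryʳ (χ n) ε₁ (χ-zero {x = n +ₚ 1ₚ} -1ₚ+1ₚ≡0ₚ) ε₂-unit
    ... | no 0≢n | no -1≢n  = trans (drop-zeros (+ 4 * match n) (at-0 n) (at--1 n))
      (4*δ≡product (χ-nonzero {x = n} (0≢n ∘ sym)) (χ-nonzero {x = n +ₚ 1ₚ} n+1≢0) ε₁-unit ε₂-unit)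
      where
      n+1≢0 : n +ₚ 1ₚ ≢ 0ₚ
      n+1≢0 eq = -1≢n (∙-cancelʳ 1ₚ -1ₚ n (trans -1ₚ+1ₚ≡0ₚ (sym eq)))
      drop-zeros : ∀ s x y → s + 0ℤ * x + 0ℤ * y ≡ s
      drop-zeros = solve-∀

    4*N : + 4 * + N p ε₁ ε₂ ≡ + p - + 2 - (ε₂ + ε₁ * χ -1ₚ + ε₁ * ε₂)
    4*N = isolate (+ 4 * + N p ε₁ ε₂) ε₁ ε₂ (χ -1ₚ) (+ p) (begin
      -- The two brackets are the boundary values `at-0 0ₚ`, simplified by χ(1) = 1, and
      -- `at--1 -1ₚ`.
      + 4 * + N p ε₁ ε₂ + (1ℤ + ε₂ * 1ℤ) + (1ℤ + ε₁ * χ -1ₚ)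
        ≡⟨ cong₂ (λ s t → + 4 * s + (1ℤ + ε₂ * t) + at--1 -1ₚ)
             (length-filter-tabulate (λ n → (χ n ℤ.≟ ε₁) ×-dec (χ (n +ₚ 1ₚ) ℤ.≟ ε₂)) id)
             (sym (trans (cong χ (+ₚ-identityˡ 1ₚ)) χ[1]≡1)) ⟩
      + 4 * (∑[ n < p ] match n) + at-0 0ₚ + at--1 -1ₚ
        ≡⟨ cong₂ _+_ (cong₂ _+_ (sym (∑-*ˡ (+ 4) match)) (sym (∑-sift 0ₚ at-0))) (sym (∑-sift -1ₚ at--1)) ⟩
      ∑[ n < p ] (+ 4 * match n) + ∑[ n < p ] (δ (0ₚ Fin.≟ n) * at-0 n) + ∑[ n < p ] (δ (-1ₚ Fin.≟ n) * at--1 n)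
        ≡⟨ cong (_+ (∑[ n < p ] (δ (-1ₚ Fin.≟ n) * at--1 n))) (∑-distrib-+ (λ n → + 4 * match n) (λ n → δ (0ₚ Fin.≟ n) * at-0 n)) ⟨
      ∑[ n < p ] (+ 4 * match n + δ (0ₚ Fin.≟ n) * at-0 n) + ∑[ n < p ] (δ (-1ₚ Fin.≟ n) * at--1 n)
        ≡⟨ ∑-distrib-+ (λ n → + 4 * match n + δ (0ₚ Fin.≟ n) * at-0 n) (λ n → δ (-1ₚ Fin.≟ n) * at--1 n) ⟨
      ∑[ n < p ] (+ 4 * match n + δ (0ₚ Fin.≟ n) * at-0 n + δ (-1ₚ Fin.≟ n) * at--1 n)
        ≡⟨ sum-cong-≗ 4*match ⟩
      ∑[ n < p ] (at--1 n * at-0 n)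
        ≡⟨ ∑-χ-product ε₁ ε₂ ⟩
      + p + ε₁ * ε₂ * (∑[ n < p ] (χ n * χ (n +ₚ 1ₚ)))
        ≡⟨ cong (λ s → + p + ε₁ * ε₂ * s) ∑χ[n]χ[n+1]≡-1 ⟩
      + p + ε₁ * ε₂ * -1ℤ ∎)
      where
      expand : ∀ m e f c → m ≡ m + (1ℤ + f * 1ℤ) + (1ℤ + e * c) - (+ 2 + f + e * c)
      expand = solve-∀
      collect : ∀ q e f c → q + e * f * -1ℤ - (+ 2 + f + e * c) ≡ q - + 2 - (f + e * c + e * f)
      collect = solve-∀
      isolate : ∀ m e f c q → m + (1ℤ + f * 1ℤ) + (1ℤ + e * c) ≡ q + e * f * -1ℤ → m ≡ q - + 2 - (f + e * c + e * f)
      isolate m e f c q eq = trans (expand m e f c) (trans (cong (_- (+ 2 + f + e * c)) eq) (collect q e f c))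

  -- The value χ(-1) and the residue of p modulo 4.

  p≡4N+4+χ[-1] : + p ≡ + 4 * + N p 1ℤ 1ℤ + + 4 + χ -1ₚ
  p≡4N+4+χ[-1] = isolate (+ 4 * + N p 1ℤ 1ℤ) (+ p) (χ -1ₚ) (4*N {1ℤ} {1ℤ} (inj₁ refl) (inj₁ refl))
    where
    expand : ∀ q c → q ≡ q - + 2 - (1ℤ + 1ℤ * c + 1ℤ * 1ℤ) + + 4 + c
    expand = solve-∀
    isolate : ∀ m q c → m ≡ q - + 2 - (1ℤ + 1ℤ * c + 1ℤ * 1ℤ) → q ≡ m + + 4 + c
    isolate m q c eq = trans (expand q c) (cong (λ t → t + + 4 + c) (sym eq))

  -- The first supplement to quadratic reciprocity, read off from `p≡4N+4+χ[-1]` modulo 4. It also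
  -- supplies the dichotomy that p is 1 or 3 modulo 4.
  χ[-1] : (χ -1ₚ ≡ 1ℤ × p % 4 ≡ 1) ⊎ (χ -1ₚ ≡ -1ℤ × p % 4 ≡ 3)
  -- The numbers 5 and 3 are the two possible values of 4 + χ(-1).
  χ[-1] = [ (λ eq → inj₁ (eq , residue 5 (trans p≡4N+4+χ[-1] (shift M (+ 4) eq))))
          , (λ eq → inj₂ (eq , residue 3 (trans p≡4N+4+χ[-1] (shift M (+ 4) eq)))) ]′
          (χ-nonzero -1ₚ≢0ₚ)
    where
    M = + N p 1ℤ 1ℤ
    commute : ∀ m a b → + 4 * m + a + b ≡ a + b + m * + 4
    commute = solve-∀
    shift : ∀ m a {b c} → b ≡ c → + 4 * m + a + b ≡ a + c + m * + 4
    shift m a {b} refl = commute m a b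
    residue : ∀ r → + p ≡ + r + M * + 4 → p % 4 ≡ r % 4
    residue r eq = trans (cong (_% 4) (ℤ.+-injective (trans eq (cong (_+_ (+ r)) (sym (ℤ.pos-* (N p 1ℤ 1ℤ) 4))))))
                         ([m+kn]%n≡m%n r (N p 1ℤ 1ℤ) 4)

  p%4≡1⇒χ[-1]≡1 : p % 4 ≡ 1 → χ -1ₚ ≡ 1ℤ
  p%4≡1⇒χ[-1]≡1 eq = [ proj₁ , (λ (_ , eq′) → contradiction (trans (sym eq) eq′) λ ()) ]′ χ[-1]

  p%4≡3⇒χ[-1]≡-1 : p % 4 ≡ 3 → χ -1ₚ ≡ -1ℤ
  p%4≡3⇒χ[-1]≡-1 eq = [ (λ (_ , eq′) → contradiction (trans (sym eq) eq′) λ ()) , proj₁ ]′ χ[-1]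

  -- The two formulas and the symmetry criterion.

  4*N-1mod4 : p % 4 ≡ 1 → ∀ {ε₁ ε₂} → IsPlusMinusOne ε₁ → IsPlusMinusOne ε₂ →
    + 4 * + N p ε₁ ε₂ ≡ + p - + 2 - (ε₂ + ε₁ + ε₁ * ε₂)
  4*N-1mod4 p%4≡1 {ε₁} {ε₂} u₁ u₂ = trans (4*N u₁ u₂)
    (cong (λ t → + p - + 2 - (ε₂ + t + ε₁ * ε₂)) (trans (cong (ε₁ *_) (p%4≡1⇒χ[-1]≡1 p%4≡1)) (ℤ.*-identityʳ ε₁)))

  4*N-3mod4 : p % 4 ≡ 3 → ∀ {ε₁ ε₂} → IsPlusMinusOne ε₁ → IsPlusMinusOne ε₂ →
    + 4 * + N p ε₁ ε₂ ≡ + p - + 2 - (ε₂ - ε₁ + ε₁ * ε₂)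
  4*N-3mod4 p%4≡3 {ε₁} {ε₂} u₁ u₂ = trans (4*N u₁ u₂)
    (cong (λ t → + p - + 2 - (ε₂ + t + ε₁ * ε₂)) (trans (cong (ε₁ *_) (p%4≡3⇒χ[-1]≡-1 p%4≡3)) (trans (ℤ.*-comm ε₁ -1ℤ) (ℤ.-1*i≡-i ε₁))))

  symmetric⇔1mod4 : ((ε₁ ε₂ : ℤ) → IsPlusMinusOne ε₁ → IsPlusMinusOne ε₂ → N p ε₁ ε₂ ≡ N p ε₂ ε₁) ⇔ p % 4 ≡ 1
  symmetric⇔1mod4 = mk⇔ symmetric⇒ ⇒symmetric
    where
    symmetric⇒ : (∀ ε₁ ε₂ → IsPlusMinusOne ε₁ → IsPlusMinusOne ε₂ → N p ε₁ ε₂ ≡ N p ε₂ ε₁) → p % 4 ≡ 1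
    -- In the remaining case p ≡ 3 (mod 4) the signs (1, -1) break symmetry: 4 N(1, -1) = p + 1,
    -- whereas 4 N(-1, 1) = p - 3.
    symmetric⇒ symmetric = [ proj₂ , (λ (_ , p%4≡3) → contradiction (symmetric 1ℤ -1ℤ (inj₁ refl) (inj₂ refl))
      (clash p (N p 1ℤ -1ℤ) (N p -1ℤ 1ℤ)
        (4*N-3mod4 p%4≡3 {1ℤ} { -1ℤ} (inj₁ refl) (inj₂ refl))
        (4*N-3mod4 p%4≡3 { -1ℤ} {1ℤ} (inj₂ refl) (inj₁ refl)))) ]′ χ[-1]
      where
      clash : ∀ q m n → + 4 * + m ≡ + q - + 2 - (-1ℤ - 1ℤ + 1ℤ * -1ℤ) → + 4 * + n ≡ + q - + 2 - (1ℤ - -1ℤ + -1ℤ * 1ℤ) → m ≢ n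
      -- The brackets evaluate to -3 and 1, so cancelling the common q - 2 leaves 3 = -1.
      clash q m .m eq eq′ refl = contradiction (ℤ-ring.+-cancelˡ (+ q - + 2) (+ 3) -1ℤ (trans (sym eq) eq′)) λ ()

    -- For p ≡ 1 (mod 4) the formula is symmetric in the two signs, and the factor 4 cancels.
    ⇒symmetric : p % 4 ≡ 1 → ∀ ε₁ ε₂ → IsPlusMinusOne ε₁ → IsPlusMinusOne ε₂ → N p ε₁ ε₂ ≡ N p ε₂ ε₁
    ⇒symmetric p%4≡1 ε₁ ε₂ u₁ u₂ = ℤ.+-injective (ℤ.*-cancelˡ-≡ (+ 4) (+ N p ε₁ ε₂) (+ N p ε₂ ε₁) (begin
      + 4 * + N p ε₁ ε₂                       ≡⟨ 4*N-1mod4 p%4≡1 u₁ u₂ ⟩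
      + p - + 2 - (ε₂ + ε₁ + ε₁ * ε₂)         ≡⟨ swap (+ p) ε₁ ε₂ ⟩
      + p - + 2 - (ε₁ + ε₂ + ε₂ * ε₁)         ≡⟨ 4*N-1mod4 p%4≡1 u₂ u₁ ⟨
      + 4 * + N p ε₂ ε₁                       ∎))
      where
      swap : ∀ q e f → q - + 2 - (f + e + e * f) ≡ q - + 2 - (e + f + f * e)
      swap = solve-∀

4*m≡k⇒m/1≡k/4 : ∀ m k → + 4 * m ≡ k → m / 1 ≡ k / 4
-- `mkℚᵘ` stores the denominator minus one, so 0 and 3 stand for 1 and 4; before normalisation,
-- equality of the fractions is cross-multiplication.
4*m≡k⇒m/1≡k/4 m k eq = fromℚᵘ-cong {mkℚᵘ m 0} {mkℚᵘ k 3} (*≡* (trans (ℤ.*-comm m (+ 4)) (trans eq (sym (ℤ.*-identityʳ k)))))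

theorem4 : (p : ℕ) .{{_ : NonZero p}} → Prime p → ¬ (2 ∣ p) →
    ((ε₁ ε₂ : ℤ) → IsPlusMinusOne ε₁ → IsPlusMinusOne ε₂ →
    (p % 4 ≡ 1 → (+ N p ε₁ ε₂) / 1 ≡ (+ p - + 2 - (ε₂ + ε₁ + ε₁ * ε₂)) / 4) ×
    (p % 4 ≡ 3 → (+ N p ε₁ ε₂) / 1 ≡ (+ p - + 2 - (ε₂ - ε₁ + ε₁ * ε₂)) / 4))
    × (((ε₁ ε₂ : ℤ) → IsPlusMinusOne ε₁ → IsPlusMinusOne ε₂ → N p ε₁ ε₂ ≡ N p ε₂ ε₁) ⇔ p % 4 ≡ 1)
theorem4 p p-prime p-odd =
  (λ ε₁ ε₂ u₁ u₂ →
    (λ p%4≡1 → 4*m≡k⇒m/1≡k/4 (+ N p ε₁ ε₂) (+ p - + 2 - (ε₂ + ε₁ + ε₁ * ε₂)) (4*N-1mod4 p%4≡1 u₁ u₂)) ,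
    (λ p%4≡3 → 4*m≡k⇒m/1≡k/4 (+ N p ε₁ ε₂) (+ p - + 2 - (ε₂ - ε₁ + ε₁ * ε₂)) (4*N-3mod4 p%4≡3 u₁ u₂))) ,
  symmetric⇔1mod4
  where open OddPrime p p-prime p-odd
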